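{- Let $p$ be an odd prime and $k\in\mathbb{N}$ with $2\le k\le \frac{p-1}{2}$ such that $p>2k+1$ and $p\equiv 1\pmod{k}$. If $n\in\{\frac{p-1}{k}+1,\frac{p-1}{k}+2,\ldots,\frac{2(p-1)}{k}-1\}$ satisfies $n\equiv\frac{p-1}{k}\pmod 2$ and $d\in\mathbb{Z}$ satisfies $\chi_k(d)=-1$, then $$S_{n,k}(d,p)\equiv 0\pmod p.$$
   Context: For an odd prime $p$ and an integer $k\ge 2$ with $k\mid p-1$, let $\alpha_1,\ldots,\alpha_{(p-1)/k}$ be integers representing the distinct (nonzero) $k$-th power residues modulo $p$. For $n\in\mathbb{N}$ and $d\in\mathbb{Z}$, $$S_{n,k}(d,p)=\det\left[(\alpha_i+d\,\alpha_j)^n\right]_{1\le i,j\le \frac{p-1}{k}}.$$ $\chi_k$ denotes a multiplicative character of order $k$ modulo $p$; for $\epsilon\in\{1,-1\}$, the condition $\chi_k(d)=\epsilon$ is equivalent to $d^{(p-1)/k}\equiv\epsilon\pmod p$. -}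

module Defs where

open import Algebra.Apartness.Bundles using (HeytingField; HeytingCommutativeRing)
open import Algebra.Bundles using (CommutativeRing; Semiring)
open import Data.Fin.Base using (Fin; zero; suc; toℕ; punchIn)
open import Data.Integer.Base using (ℤ; +_; -_; _+_; _-_; _*_; _^_; 1ℤ; -1ℤ)
open import Data.Integer.Divisibility.Signed using (_∣_)
open import Data.Integer.Properties using (+-0-monoid)
open import Data.Nat.Base as ℕ using (ℕ; zero; suc; NonZero; _∸_; _/_)
open import Data.Product.Base using (_×_; ∃-syntax)
open import Level using (Level; _⊔_)
open import Relation.Binary.PropositionalEquality.Core using (_≡_)
open import Relation.Nullary.Negation using (¬_)

open import Algebra.Properties.Monoid.Sum +-0-monoid using (sum)

infix 4 _≡_mod_

_≡_mod_ : ℤ → ℤ → ℕ → Set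
a ≡ b mod m = + m ∣ a - b

Matrix : ℕ → Set
Matrix n = Fin n → Fin n → ℤ

-- Laplace expansion along the first row.
det : ∀ {n} → Matrix n → ℤ
det {zero}  A = 1ℤ
det {suc n} A =
  sum (λ j → -1ℤ ^ toℕ j * A zero j * det (λ i l → A (suc i) (punchIn j l)))

IsPowerResidue : (k p : ℕ) → ℤ → Set
IsPowerResidue k p a = ¬ (a ≡ + 0 mod p) × ∃[ x ] (x ^ k ≡ a mod p)

record RepresentsPowerResidues (k p : ℕ) {m : ℕ} (α : Fin m → ℤ) : Set where
  field
    residue  : ∀ i → IsPowerResidue k p (α i)
    distinct : ∀ i j → α i ≡ α j mod p → i ≡ j
    complete : ∀ a → IsPowerResidue k p a → ∃[ i ] (α i ≡ a mod p)

S : (n k : ℕ) .{{_ : NonZero k}} (d : ℤ) (p : ℕ) → (Fin ((p ∸ 1) / k) → ℤ) → ℤ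
S n k d p α = det (λ i j → (α i + d * α j) ^ n)

-- The field F takes the place of ℂ as the value field of characters.
module _ {c ℓ₁ ℓ₂ : Level} (F : HeytingField c ℓ₁ ℓ₂) where

  private
    module F = HeytingField F
    ring : CommutativeRing c ℓ₁
    ring = HeytingCommutativeRing.commutativeRing F.heytingCommutativeRing

  open import Algebra.Definitions.RawSemiring (Semiring.rawSemiring (CommutativeRing.semiring ring)) using () renaming (_×_ to _·_; _^_ to _^F_)

  CharacteristicZero : Set ℓ₁
  CharacteristicZero = ∀ n → ¬ (suc n · F.1# F.≈ F.0#)

  -- A character of (ℤ/p)ˣ, lifted to ℤ and extended by 0 to the multiples of p.
  record IsMultiplicativeCharacter (p : ℕ) (χ : ℤ → F.Carrier) : Set (c ⊔ ℓ₁) where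
    field
      periodic  : ∀ a b → a ≡ b mod p → χ a F.≈ χ b
      one       : χ 1ℤ F.≈ F.1#
      mult      : ∀ a b → χ (a * b) F.≈ χ a F.* χ b
      vanishing : ∀ a → a ≡ + 0 mod p → χ a F.≈ F.0#

  PowerIsTrivial : (p : ℕ) → (ℤ → F.Carrier) → ℕ → Set ℓ₁
  PowerIsTrivial p χ j = ∀ a → ¬ (a ≡ + 0 mod p) → χ a ^F j F.≈ F.1#

  record IsCharacterOfOrder (k p : ℕ) (χ : ℤ → F.Carrier) : Set (c ⊔ ℓ₁) where
    field
      isCharacter : IsMultiplicativeCharacter p χ
      trivial     : PowerIsTrivial p χ k
      minimal     : ∀ j → 0 ℕ.< j → j ℕ.< k → ¬ PowerIsTrivial p χ j

-- Put m = (p − 1) / k and n = m + 2 r, so that 0 ≤ r < m.  Multiplication by a residue permutes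
-- the α j, hence α j ^ m = 1 and the power sum ∑ⱼ α j ^ e vanishes mod p unless m ∣ e.
-- The vector x j = α j ^ (m − r) therefore kills every binomial term of
-- ∑ⱼ (α i + d α j) ^ n x j except those of exponents r and m + r = n − r, which have the same
-- binomial coefficient and opposite signs, because d ^ m = −1.  So the matrix has a kernel
-- vector with invertible entries.
--
-- For d ^ m = −1, let t be the order of d ^ m.  It divides k, and every x ^ (k / t) is a root
-- of y ^ (t m) = 1, hence of the form d ^ i α j.  As χ (d) = −1 and χ (α j) = 1, this gives
-- χ ^ (2 k / t) = 1, so t ≤ 2; and t = 1 would make d a residue.
module Submission where

open import Defs
import Algebra.Properties.CommutativeMonoid.Sum as MonoidSum
import Algebra.Properties.CommutativeSemiring.Binomial as Binomial
import Algebra.Properties.Ring as RingProperties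
import Algebra.Properties.Semiring.Exp as Exp
import Algebra.Properties.Semiring.Mult as Mult
import Algebra.Properties.Semiring.Sum as SemiringSum
open import Algebra.Apartness.Bundles using (HeytingField; HeytingCommutativeRing)
open import Algebra.Bundles using (CommutativeRing)
open import Data.Fin.Base using (Fin; zero; suc; toℕ; fromℕ<; inject≤; inject₁;
  punchIn; opposite; remQuot; combine)
open import Data.Fin.Induction using (<-weakInduction)
open import Data.Fin.Permutation as Permutation using (permutation; _⟨$⟩ʳ_)
import Data.Fin.Properties as Fin
open import Data.Integer.Base using (ℤ; +_; -_; _+_; _*_; _-_; _^_; 0ℤ; 1ℤ; -1ℤ; ∣_∣)
open import Data.Integer.Divisibility.Signed using (_∣_; divides; _∣?_;
  ∣⇒∣ᵤ; ∣ᵤ⇒∣; ∣m∣n⇒∣m+n; ∣m⇒∣-m; ∣m⇒∣m*n; ∣n⇒∣m*n)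
import Data.Integer.Properties as ℤ
open import Data.Integer.Tactic.RingSolver using (solve-∀)
open import Data.Nat.Base as ℕ using (ℕ; zero; suc; NonZero; _∸_; _/_; _≤_; _<_; z<s)
open import Data.Nat.Combinatorics using (_C_; nCk≡nC[n∸k])
open import Data.Nat.DivMod using (_%_; m≡m%n+[m/n]*n; m%n<n; *-/-assoc)
open import Data.Nat.Divisibility as ℕ∣ using (_∤_)
open import Data.Nat.Induction using (<-rec)
open import Data.Nat.Primality using (Prime; euclidsLemma; prime⇒nonTrivial)
import Data.Nat.Properties as ℕ
import Data.Nat.Tactic.RingSolver as ℕ-Solver
open import Data.Product.Base using (_×_; _,_; proj₁; proj₂; ∃-syntax)
open import Data.Sum.Base as Sum using (_⊎_; inj₁; inj₂)
open import Data.Vec.Base using (Vec; []; _∷_; replicate)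
open import Function.Base using (_∘_)
open import Level using (Level; 0ℓ)
open import Relation.Binary.Definitions using (Decidable; tri<; tri≈; tri>)
open import Relation.Binary.PropositionalEquality as ≡ using (_≡_; refl; cong; cong₂; subst)
import Relation.Binary.Reasoning.Setoid as SetoidReasoning
open import Relation.Nullary using (¬_; yes; no; contradiction)
open import Relation.Nullary.Decidable using (map′; _×-dec_)
import Relation.Unary as U

open MonoidSum ℤ.+-0-commutativeMonoid using () renaming (sum to ∑; sum-cong-≗ to ∑-cong-≗)

-- Determinants

sum-linear : ∀ {n} (a b : ℤ) (f g : Fin n → ℤ) →
             ∑ (λ i → a * f i + b * g i) ≡ a * ∑ f + b * ∑ g
sum-linear {zero}  a b f g = eq a b
  where
  eq : ∀ a b → 0ℤ ≡ a * 0ℤ + b * 0ℤ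
  eq = solve-∀
sum-linear {suc n} a b f g =
  ≡.trans (cong (λ s → a * f zero + b * g zero + s) (sum-linear a b (f ∘ suc) (g ∘ suc)))
    (eq a b (f zero) (g zero) (∑ (f ∘ suc)) (∑ (g ∘ suc)))
  where
  eq : ∀ a b x y u v →
       a * x + b * y + (a * u + b * v) ≡ a * (x + u) + b * (y + v)
  eq = solve-∀

sum-neg : ∀ {n} (f : Fin n → ℤ) → ∑ (λ i → - f i) ≡ - ∑ f
sum-neg {zero}  f = refl
sum-neg {suc n} f =
  ≡.trans (cong (λ s → - f zero + s) (sum-neg (f ∘ suc)))
    (≡.sym (ℤ.neg-distrib-+ (f zero) (∑ (f ∘ suc))))

det-cong : ∀ {n} {A B : Matrix n} → (∀ i j → A i j ≡ B i j) → det A ≡ det B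
det-cong {zero}  A≡B = refl
det-cong {suc n} A≡B = ∑-cong-≗ λ j →
  cong₂ (λ a D → -1ℤ ^ toℕ j * a * D)
    (A≡B zero j) (det-cong λ i l → A≡B (suc i) (punchIn j l))

adjacentSwap : ∀ {n} → Fin n → Fin (suc n) → Fin (suc n)
adjacentSwap zero    zero          = suc zero
adjacentSwap zero    (suc zero)    = zero
adjacentSwap zero    (suc (suc j)) = suc (suc j)
adjacentSwap (suc i) zero          = zero
adjacentSwap (suc i) (suc j)       = suc (adjacentSwap i j)

adjacent-inject₁ : ∀ {n} (i : Fin n) → adjacentSwap i (inject₁ i) ≡ suc i
adjacent-inject₁ zero    = refl
adjacent-inject₁ (suc i) = cong suc (adjacent-inject₁ i)

sum-adjacent : ∀ {n} (i : Fin n) (f : Fin (suc n) → ℤ) →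
               ∑ (f ∘ adjacentSwap i) ≡ ∑ f
sum-adjacent zero    f = eq (f (suc zero)) (f zero) _
  where
  eq : ∀ x y z → x + (y + z) ≡ y + (x + z)
  eq = solve-∀
sum-adjacent (suc i) f = cong (λ s → f zero + s) (sum-adjacent i (f ∘ suc))

-- How an adjacent column swap acts on the Laplace cofactor of column `l`. Away from the two swapped
-- columns the minor undergoes an adjacent swap itself; at one of them the two minors trade places
-- unaltered and the sign flips, since the positions differ by one.
data AdjacentPunchIn {n} (i : Fin (suc n)) (l : Fin (suc (suc n))) : Set where
  fixed : ∀ (i′ : Fin n) → adjacentSwap i l ≡ l →
          (∀ x → adjacentSwap i (punchIn l x) ≡ punchIn l (adjacentSwap i′ x)) →
          AdjacentPunchIn i l
  moved : -1ℤ ^ toℕ l ≡ - (-1ℤ ^ toℕ (adjacentSwap i l)) →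
          (∀ x → adjacentSwap i (punchIn l x) ≡ punchIn (adjacentSwap i l) x) →
          AdjacentPunchIn i l

adjacentPunchIn : ∀ {n} (i : Fin (suc n)) (l : Fin (suc (suc n))) →
                  AdjacentPunchIn i l
adjacentPunchIn zero zero = moved refl λ { zero → refl ; (suc x) → refl }
adjacentPunchIn zero (suc zero) = moved refl λ { zero → refl ; (suc x) → refl }
adjacentPunchIn {suc n} zero (suc (suc l)) = fixed zero refl
  λ { zero → refl ; (suc zero) → refl ; (suc (suc x)) → refl }
adjacentPunchIn {suc n} (suc i) zero = fixed i refl λ x → refl
adjacentPunchIn {suc n} (suc i) (suc l) with adjacentPunchIn i l
... | fixed i′ eq eqs = fixed (suc i′) (cong suc eq)
  λ { zero → refl ; (suc x) → cong suc (eqs x) }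
... | moved eq eqs = moved
  (≡.trans (cong (-1ℤ *_) eq) (≡.sym (ℤ.neg-distribʳ-* -1ℤ _)))
  λ { zero → refl ; (suc x) → cong suc (eqs x) }

-- Every Laplace term becomes the negative of the term at the swapped index, either by induction on
-- the minor or through the sign of the cofactor; `sum-adjacent` then restores the order of
-- summation.
det-adjacent : ∀ {n} (i : Fin n) (A : Matrix (suc n)) →
               det (λ r c → A r (adjacentSwap i c)) ≡ - det A
det-adjacent {suc n} i A = begin
  ∑ (λ l → -1ℤ ^ toℕ l * A zero (adjacentSwap i l)
             * det (λ r c → A (suc r) (adjacentSwap i (punchIn l c))))
                                 ≡⟨ ∑-cong-≗ step ⟩
  ∑ (λ l → - g (adjacentSwap i l)) ≡⟨ sum-neg (g ∘ adjacentSwap i) ⟩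
  - ∑ (g ∘ adjacentSwap i)         ≡⟨ cong -_ (sum-adjacent i g) ⟩
  - ∑ g                        ∎
  where
  open ≡.≡-Reasoning
  g : Fin (suc (suc n)) → ℤ
  g l = -1ℤ ^ toℕ l * A zero l * det (λ r c → A (suc r) (punchIn l c))
  step : ∀ l → -1ℤ ^ toℕ l * A zero (adjacentSwap i l)
               * det (λ r c → A (suc r) (adjacentSwap i (punchIn l c)))
             ≡ - g (adjacentSwap i l)
  step l with adjacentPunchIn i l
  ... | fixed i′ eq eqs rewrite eq = begin
    s * det (λ r c → A (suc r) (adjacentSwap i (punchIn l c)))
      ≡⟨ cong (s *_) (det-cong λ r c → cong (A (suc r)) (eqs c)) ⟩
    s * det (λ r c → A (suc r) (punchIn l (adjacentSwap i′ c)))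
      ≡⟨ cong (s *_) (det-adjacent i′ (λ r c → A (suc r) (punchIn l c))) ⟩
    s * - det (λ r c → A (suc r) (punchIn l c))
      ≡⟨ ℤ.neg-distribʳ-* s _ ⟨
    - g l ∎
    where s = -1ℤ ^ toℕ l * A zero l
  ... | moved eq eqs = begin
    -1ℤ ^ toℕ l * a * det (λ r c → A (suc r) (adjacentSwap i (punchIn l c)))
      ≡⟨ cong₂ (λ s D → s * a * D) eq
           (det-cong λ r c → cong (A (suc r)) (eqs c)) ⟩
    - (-1ℤ ^ toℕ (adjacentSwap i l)) * a
      * det (λ r c → A (suc r) (punchIn (adjacentSwap i l) c))
      ≡⟨ neg³ (-1ℤ ^ toℕ (adjacentSwap i l)) a _ ⟩
    - g (adjacentSwap i l) ∎
    where
    a = A zero (adjacentSwap i l)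
    neg³ : ∀ x y z → - x * y * z ≡ - (x * y * z)
    neg³ = solve-∀

i≡-i⇒i≡0 : ∀ {i} → i ≡ - i → i ≡ 0ℤ
i≡-i⇒i≡0 {+ zero} refl = refl

-- Adjacent swaps carry column `suc j` leftwards until it stands next to column 0, each changing
-- only the sign. There one more swap fixes the matrix, so the determinant is its own negative, and
-- ℤ has no 2-torsion.
det-equal-columns : ∀ {n} (j : Fin n) (A : Matrix (suc n)) →
                    (∀ i → A i zero ≡ A i (suc j)) → det A ≡ 0ℤ
det-equal-columns {suc n} = <-weakInduction P base step
  where
  P : Fin (suc n) → Set
  P j = ∀ A → (∀ i → A i zero ≡ A i (suc j)) → det A ≡ 0ℤ
  base : P zero
  base A eq = i≡-i⇒i≡0 (≡.trans (det-cong swap) (det-adjacent zero A))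
    where
    swap : ∀ i j → A i j ≡ A i (adjacentSwap zero j)
    swap i zero          = eq i
    swap i (suc zero)    = ≡.sym (eq i)
    swap i (suc (suc j)) = refl
  step : ∀ j → P (inject₁ j) → P (suc j)
  step j IH A eq = ℤ.neg-injective (≡.trans (≡.sym (det-adjacent (suc j) A))
    (IH (λ r c → A r (adjacentSwap (suc j) c))
        (λ i → ≡.trans (eq i) (cong (A i ∘ suc) (≡.sym (adjacent-inject₁ j))))))

infixr 5 _◂_

_◂_ : ∀ {m n} → (Fin m → ℤ) → (Fin m → Fin n → ℤ) → Fin m → Fin (suc n) → ℤ
(v ◂ B) i zero    = v i
(v ◂ B) i (suc j) = B i j

-- The expansion runs along the first row, whereas linearity concerns the first column: the term of
-- index 0 is linear through its entry, the others through their minors, which again begin with the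
-- shortened column.
det-linear : ∀ {n} (a b : ℤ) (u w : Fin (suc n) → ℤ) (B : Fin (suc n) → Fin n → ℤ) →
             det ((λ i → a * u i + b * w i) ◂ B) ≡ a * det (u ◂ B) + b * det (w ◂ B)
det-linear {n} a b u w B =
  ≡.trans (∑-cong-≗ term) (sum-linear a b (terms u) (terms w))
  where
  terms : (Fin (suc n) → ℤ) → Fin (suc n) → ℤ
  terms v j = -1ℤ ^ toℕ j * (v ◂ B) zero j * det (λ i l → (v ◂ B) (suc i) (punchIn j l))
  term : ∀ j → terms (λ i → a * u i + b * w i) j ≡ a * terms u j + b * terms w j
  term zero = eq a b (u zero) (w zero) _
    where
    eq : ∀ a b x y z → 1ℤ * (a * x + b * y) * z ≡ a * (1ℤ * x * z) + b * (1ℤ * y * z)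
    eq = solve-∀
  -- An element `j` of `Fin n` forces `n` to be a successor, and only then does the minor have a
  -- first column; `go` abstracts over the size so that it can be matched.
  term (suc j) = go B j
    where
    go : ∀ {n} {u w : Fin (suc n) → ℤ} (B : Fin (suc n) → Fin n → ℤ) (j : Fin n) →
         let s = -1ℤ ^ suc (toℕ j) * B zero j
             D = λ v → det (λ i l → (v ◂ B) (suc i) (punchIn (suc j) l))
         in s * D (λ i → a * u i + b * w i) ≡ a * (s * D u) + b * (s * D w)
    go {suc n} {u} {w} B j = begin
      s * D (λ i → a * u i + b * w i)     ≡⟨ cong (s *_) (det-cong (shape λ i → a * u i + b * w i)) ⟩
      s * det ((λ i → a * u (suc i) + b * w (suc i)) ◂ B′)
        ≡⟨ cong (s *_) (det-linear a b (u ∘ suc) (w ∘ suc) B′) ⟩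
      s * (a * det ((u ∘ suc) ◂ B′) + b * det ((w ∘ suc) ◂ B′))
        ≡⟨ cong₂ (λ x y → s * (a * x + b * y))
             (det-cong (shape u)) (det-cong (shape w)) ⟨
      s * (a * D u + b * D w)             ≡⟨ eq s a b _ _ ⟩
      a * (s * D u) + b * (s * D w)       ∎
      where
      open ≡.≡-Reasoning
      s = -1ℤ ^ suc (toℕ j) * B zero j
      D = λ v → det (λ i l → (v ◂ B) (suc i) (punchIn (suc j) l))
      B′ : Fin (suc n) → Fin n → ℤ
      B′ i l = B (suc i) (punchIn j l)
      shape : ∀ v i l → (v ◂ B) (suc i) (punchIn (suc j) l) ≡ ((v ∘ suc) ◂ B′) i l
      shape v i zero    = refl
      shape v i (suc l) = refl
      eq : ∀ s a b x y → s * (a * x + b * y) ≡ a * (s * x) + b * (s * y)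
      eq = solve-∀

◂-cong : ∀ {n} {u w : Fin (suc n) → ℤ} (B : Fin (suc n) → Fin n → ℤ) →
         (∀ i → u i ≡ w i) → det (u ◂ B) ≡ det (w ◂ B)
◂-cong {u = u} {w} B u≡w = det-cong {A = u ◂ B} {B = w ◂ B} λ { i zero → u≡w i ; i (suc j) → refl }

det-scale : ∀ {n} (a : ℤ) (u : Fin (suc n) → ℤ) (B : Fin (suc n) → Fin n → ℤ) →
            det ((λ i → a * u i) ◂ B) ≡ a * det (u ◂ B)
det-scale a u B = begin
  det ((λ i → a * u i) ◂ B)                 ≡⟨ ◂-cong B (λ i → eq a (u i)) ⟩
  det ((λ i → a * u i + 0ℤ * u i) ◂ B)      ≡⟨ det-linear a 0ℤ u u B ⟩
  a * det (u ◂ B) + 0ℤ * det (u ◂ B)        ≡⟨ eq a _ ⟨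
  a * det (u ◂ B)                           ∎
  where
  open ≡.≡-Reasoning
  eq : ∀ a x → a * x ≡ a * x + 0ℤ * x
  eq = solve-∀

-- The number `m` of combined columns is independent of the size of the matrix, which lets induction
-- peel them off one by one.
det-combination : ∀ {m n} (x : Fin m → ℤ) (V : Fin (suc n) → Fin m → ℤ)
                  (B : Fin (suc n) → Fin n → ℤ) →
                  det ((λ i → ∑ (λ j → V i j * x j)) ◂ B) ≡
                  ∑ (λ j → x j * det ((λ i → V i j) ◂ B))
det-combination {zero}  x V B =
  det-scale 0ℤ (λ _ → 0ℤ) B
det-combination {suc m} x V B = begin
  det ((λ i → V i zero * x zero + S′ i) ◂ B)
    ≡⟨ ◂-cong B (λ i → eq (V i zero) (x zero) (S′ i)) ⟩
  det ((λ i → x zero * V i zero + 1ℤ * S′ i) ◂ B)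
    ≡⟨ det-linear (x zero) 1ℤ (λ i → V i zero) S′ B ⟩
  x zero * det ((λ i → V i zero) ◂ B) + 1ℤ * det (S′ ◂ B)
    ≡⟨ cong (λ s → x zero * det ((λ i → V i zero) ◂ B) + s)
         (≡.trans (ℤ.*-identityˡ _) (det-combination (x ∘ suc) (λ i → V i ∘ suc) B)) ⟩
  ∑ (λ j → x j * det ((λ i → V i j) ◂ B)) ∎
  where
  open ≡.≡-Reasoning
  S′ : Fin _ → ℤ
  S′ i = ∑ (λ j → V i (suc j) * x (suc j))
  eq : ∀ v x s → v * x + s ≡ x * v + 1ℤ * s
  eq = solve-∀

sum-zero : ∀ {n} {f : Fin n → ℤ} → (∀ i → f i ≡ 0ℤ) → ∑ f ≡ 0ℤ
sum-zero {zero}  f≡0 = refl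
sum-zero {suc n} f≡0 = cong₂ _+_ (f≡0 zero) (sum-zero (f≡0 ∘ suc))

-- Replace column 0 of A by the combination A x of all columns.
kernel⇒∣x₀*det : ∀ {n} {z : ℤ} (A : Matrix (suc n)) (x : Fin (suc n) → ℤ) →
                 (∀ i → z ∣ ∑ (λ j → A i j * x j)) → z ∣ x zero * det A
kernel⇒∣x₀*det {n} {z} A x z∣Ax = divides (det (q ◂ B)) (begin
  x zero * det A
    ≡⟨ cong (x zero *_) (det-cong {A = A} {B = (λ i → A i zero) ◂ B}
         λ { i zero → refl ; i (suc j) → refl }) ⟩
  x zero * det ((λ i → A i zero) ◂ B)
    ≡⟨ ℤ.+-identityʳ _ ⟨
  x zero * det ((λ i → A i zero) ◂ B) + 0ℤ
    ≡⟨ cong (λ s → x zero * det ((λ i → A i zero) ◂ B) + s) (sum-zero repeated) ⟨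
  ∑ (λ j → x j * det ((λ i → A i j) ◂ B))
    ≡⟨ det-combination x A B ⟨
  det ((λ i → ∑ (λ j → A i j * x j)) ◂ B)
    ≡⟨ ◂-cong B (λ i → ≡.trans (_∣_.equality (z∣Ax i)) (ℤ.*-comm (q i) z)) ⟩
  det ((λ i → z * q i) ◂ B)
    ≡⟨ det-scale z q B ⟩
  z * det (q ◂ B)
    ≡⟨ ℤ.*-comm z _ ⟩
  det (q ◂ B) * z ∎)
  where
  open ≡.≡-Reasoning
  B : Fin (suc n) → Fin n → ℤ
  B i j = A i (suc j)
  q : Fin (suc n) → ℤ
  q i = _∣_.quotient (z∣Ax i)
  -- Column `suc j` already occurs in `B`, so of the whole combination only the term of column 0
  -- survives.
  repeated : ∀ j → x (suc j) * det ((λ i → A i (suc j)) ◂ B) ≡ 0ℤ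
  repeated j = ≡.trans
    (cong (x (suc j) *_) (det-equal-columns j ((λ i → A i (suc j)) ◂ B) λ i → refl))
    (ℤ.*-zeroʳ (x (suc j)))

-- Integers modulo p

^-distribʳ-* : ∀ a b n → (a * b) ^ n ≡ a ^ n * b ^ n
^-distribʳ-* a b zero    = refl
^-distribʳ-* a b (suc n) =
  ≡.trans (cong (a * b *_) (^-distribʳ-* a b n)) (eq a b (a ^ n) (b ^ n))
  where
  eq : ∀ a b x y → a * b * (x * y) ≡ a * x * (b * y)
  eq = solve-∀

module Congruence (p : ℕ) where

  infix 4 _≈_ _≉_

  -- A record, so that a and b can be inferred from a proof.
  record _≈_ (a b : ℤ) : Set where
    constructor modulo
    field difference : a ≡ b mod p

  open _≈_ public

  _≉_ : ℤ → ℤ → Set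
  a ≉ b = ¬ (a ≈ b)

  private
    via : ∀ {a b c} → c ≡ a - b → + p ∣ c → a ≈ b
    via eq p∣c = modulo (subst (+ p ∣_) eq p∣c)

  ≡⇒≈ : ∀ {a b} → a ≡ b → a ≈ b
  ≡⇒≈ {a} refl = via {a = a} (≡.sym (ℤ.+-inverseʳ a)) (divides 0ℤ refl)

  ≈-sym : ∀ {a b} → a ≈ b → b ≈ a
  ≈-sym {a} {b} (modulo h) = via (eq a b) (∣m⇒∣-m h)
    where
    eq : ∀ a b → - (a - b) ≡ b - a
    eq = solve-∀

  ≈-trans : ∀ {a b c} → a ≈ b → b ≈ c → a ≈ c
  ≈-trans {a} {b} {c} (modulo h) (modulo h′) = via (eq a b c) (∣m∣n⇒∣m+n h h′)
    where
    eq : ∀ a b c → a - b + (b - c) ≡ a - c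
    eq = solve-∀

  +-cong : ∀ {a b c d} → a ≈ b → c ≈ d → a + c ≈ b + d
  +-cong {a} {b} {c} {d} (modulo h) (modulo h′) = via (eq a b c d) (∣m∣n⇒∣m+n h h′)
    where
    eq : ∀ a b c d → a - b + (c - d) ≡ a + c - (b + d)
    eq = solve-∀

  *-cong : ∀ {a b c d} → a ≈ b → c ≈ d → a * c ≈ b * d
  *-cong {a} {b} {c} {d} (modulo h) (modulo h′) =
    via (eq a b c d) (∣m∣n⇒∣m+n (∣m⇒∣m*n c h) (∣n⇒∣m*n b h′))
    where
    eq : ∀ a b c d → (a - b) * c + b * (c - d) ≡ a * c - b * d
    eq = solve-∀

  -‿cong : ∀ {a b} → a ≈ b → - a ≈ - b
  -‿cong {a} {b} (modulo h) = via (eq a b) (∣m⇒∣-m h)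
    where
    eq : ∀ a b → - (a - b) ≡ - a - - b
    eq = solve-∀

  -- The residue ring as a setoid on ℤ with the integer operations: identities of integers pass over
  -- through `≡⇒≈`, and the generic results on finite sums and binomials apply modulo `p`.
  ring : CommutativeRing 0ℓ 0ℓ
  ring = record
    { Carrier = ℤ ; _≈_ = _≈_ ; _+_ = _+_ ; _*_ = _*_ ; -_ = -_ ; 0# = 0ℤ ; 1# = 1ℤ
    ; isCommutativeRing = record
      { isRing = record
        { +-isAbelianGroup = record
          { isGroup = record
            { isMonoid = record
              { isSemigroup = record
                { isMagma = record
                  { isEquivalence = record { refl = ≡⇒≈ refl ; sym = ≈-sym ; trans = ≈-trans }
                  ; ∙-cong = +-cong }
                ; assoc = λ a b c → ≡⇒≈ (ℤ.+-assoc a b c) }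
              ; identity = (λ a → ≡⇒≈ (ℤ.+-identityˡ a)) , (λ a → ≡⇒≈ (ℤ.+-identityʳ a)) }
            ; inverse = (λ a → ≡⇒≈ (ℤ.+-inverseˡ a)) , (λ a → ≡⇒≈ (ℤ.+-inverseʳ a))
            ; ⁻¹-cong = -‿cong }
          ; comm = λ a b → ≡⇒≈ (ℤ.+-comm a b) }
        ; *-cong = *-cong
        ; *-assoc = λ a b c → ≡⇒≈ (ℤ.*-assoc a b c)
        ; *-identity = (λ a → ≡⇒≈ (ℤ.*-identityˡ a)) , (λ a → ≡⇒≈ (ℤ.*-identityʳ a))
        ; distrib = (λ a b c → ≡⇒≈ (ℤ.*-distribˡ-+ a b c)) , (λ a b c → ≡⇒≈ (ℤ.*-distribʳ-+ a b c)) }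
      ; *-comm = λ a b → ≡⇒≈ (ℤ.*-comm a b) } }

  open CommutativeRing ring public
    using (setoid; +-commutativeMonoid; *-commutativeMonoid; semiring; commutativeSemiring;
           *-congˡ; *-congʳ)
    renaming (refl to ≈-refl)

  ≈0⇒∣ : ∀ {a} → a ≈ 0ℤ → + p ∣ a
  ≈0⇒∣ {a} (modulo h) = subst (+ p ∣_) (ℤ.+-identityʳ a) h

  ∣⇒≈0 : ∀ {a} → + p ∣ a → a ≈ 0ℤ
  ∣⇒≈0 {a} = via (≡.sym (ℤ.+-identityʳ a))

  infix 4 _≈?_
  _≈?_ : Decidable _≈_
  a ≈? b = map′ modulo difference (+ p ∣? a - b)

  ≈⇒-≈0 : ∀ {a b} → a ≈ b → a - b ≈ 0ℤ
  ≈⇒-≈0 (modulo h) = ∣⇒≈0 h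

  -≈0⇒≈ : ∀ {a b} → a - b ≈ 0ℤ → a ≈ b
  -≈0⇒≈ = modulo ∘ ≈0⇒∣

  ^-congˡ : ∀ {a b} n → a ≈ b → a ^ n ≈ b ^ n
  ^-congˡ zero    a≈b = ≈-refl
  ^-congˡ (suc n) a≈b = *-cong a≈b (^-congˡ n a≈b)

  ≈0⇒^≈0 : ∀ {a} n .{{_ : NonZero n}} → a ≈ 0ℤ → a ^ n ≈ 0ℤ
  ≈0⇒^≈0 {a} (suc n) a≈0 = ≈-trans (*-congʳ {a ^ n} a≈0) (≡⇒≈ (ℤ.*-zeroˡ (a ^ n)))

  ≈1⇒^≈1 : ∀ {a} n → a ≈ 1ℤ → a ^ n ≈ 1ℤ
  ≈1⇒^≈1 n a≈1 = ≈-trans (^-congˡ n a≈1) (≡⇒≈ (ℤ.^-zeroˡ n))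

-- Cancellation and polynomial roots modulo a prime

module PrimeCongruence (p : ℕ) (p-prime : Prime p) where

  open Congruence p public

  1≉0 : 1ℤ ≉ 0ℤ
  1≉0 1≈0 = contradiction (ℕ∣.∣1⇒≡1 (∣⇒∣ᵤ (≈0⇒∣ 1≈0)))
    (ℕ.nonTrivial⇒≢1 {{prime⇒nonTrivial p-prime}})

  integral : ∀ a b → a * b ≈ 0ℤ → a ≈ 0ℤ ⊎ b ≈ 0ℤ
  integral a b ab≈0 = Sum.map (∣⇒≈0 ∘ ∣ᵤ⇒∣) (∣⇒≈0 ∘ ∣ᵤ⇒∣)
    (euclidsLemma ∣ a ∣ ∣ b ∣ p-prime (subst (p ℕ∣.∣_) (ℤ.abs-* a b) (∣⇒∣ᵤ (≈0⇒∣ ab≈0))))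

  *-≉0 : ∀ {a b} → a ≉ 0ℤ → b ≉ 0ℤ → a * b ≉ 0ℤ
  *-≉0 {a} {b} a≉0 b≉0 = Sum.[ a≉0 , b≉0 ] ∘ integral a b

  ^-≉0 : ∀ {a} n → a ≉ 0ℤ → a ^ n ≉ 0ℤ
  ^-≉0 zero    a≉0 = 1≉0
  ^-≉0 (suc n) a≉0 = *-≉0 a≉0 (^-≉0 n a≉0)

  *-cancelˡ : ∀ {a b} c → c ≉ 0ℤ → c * a ≈ c * b → a ≈ b
  *-cancelˡ {a} {b} c c≉0 ca≈cb = Sum.[ (λ c≈0 → contradiction c≈0 c≉0) , -≈0⇒≈ {a} {b} ]′
    (integral c (a - b) (≈-trans (≡⇒≈ (eq c a b)) (≈⇒-≈0 ca≈cb)))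
    where
    eq : ∀ c a b → c * (a - b) ≡ c * a - c * b
    eq = solve-∀

  -- The monic polynomial of degree n with lower coefficients c, constant
  -- coefficient first.
  monic : ∀ {n} → Vec ℤ n → ℤ → ℤ
  monic []      x = 1ℤ
  monic (a ∷ c) x = a + x * monic c x

  -- Synthetic division by `x - r`: the coefficients are the partial results of Horner's scheme at
  -- `r`.
  quotient : ∀ {n} → ℤ → Vec ℤ (suc n) → Vec ℤ n
  quotient         r (a ∷ [])        = []
  quotient {suc n} r (a ∷ c@(_ ∷ _)) = monic c r ∷ quotient r c

  monic-quotient : ∀ {n} r (c : Vec ℤ (suc n)) x →
                   monic c x - monic c r ≡ (x - r) * monic (quotient r c) x
  monic-quotient r (a ∷ []) x = eq a x r
    where
    eq : ∀ a x r → a + x * 1ℤ - (a + r * 1ℤ) ≡ (x - r) * 1ℤ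
    eq = solve-∀
  monic-quotient r (a ∷ c@(_ ∷ _)) x = begin
    a + x * cx - (a + r * cr)        ≡⟨ eq₁ a x r cx cr ⟩
    (x - r) * cr + x * (cx - cr)     ≡⟨ cong (λ z → (x - r) * cr + x * z) (monic-quotient r c x) ⟩
    (x - r) * cr + x * ((x - r) * q) ≡⟨ eq₂ x r cr q ⟩
    (x - r) * (cr + x * q)           ∎
    where
    open ≡.≡-Reasoning
    cx = monic c x
    cr = monic c r
    q  = monic (quotient r c) x
    eq₁ : ∀ a x r u v → a + x * u - (a + r * v) ≡ (x - r) * v + x * (u - v)
    eq₁ = solve-∀
    eq₂ : ∀ x r v q → (x - r) * v + x * ((x - r) * q) ≡ (x - r) * (v + x * q)
    eq₂ = solve-∀

  Distinct : ∀ {n} → (Fin n → ℤ) → Set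
  Distinct r = ∀ i j → r i ≈ r j → i ≡ j

  -- Lagrange's bound on the number of roots, in the form that `n` distinct roots exhaust them all.
  -- Modulo a prime, every root other than `r zero` is a root of the quotient by `x - r zero`; in
  -- degree 0 the polynomial is 1.
  monic-roots : ∀ {n} (c : Vec ℤ n) (r : Fin n → ℤ) → Distinct r →
                (∀ i → monic c (r i) ≈ 0ℤ) → ∀ y → monic c y ≈ 0ℤ → ∃[ i ] r i ≈ y
  monic-roots {zero}  []      r distinct root y y-root = contradiction y-root 1≉0
  monic-roots {suc n} c r distinct root y y-root = go (y ≈? r zero)
    where
    factor : ∀ x → x ≉ r zero → monic c x ≈ 0ℤ → monic (quotient (r zero) c) x ≈ 0ℤ
    factor x x≉r₀ x-root =
      Sum.[ (λ x-r₀≈0 → contradiction (-≈0⇒≈ x-r₀≈0) x≉r₀) , (λ q≈0 → q≈0) ]′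
        (integral (x - r zero) _ (≈-trans (≡⇒≈ (≡.sym (monic-quotient (r zero) c x)))
          (+-cong x-root (-‿cong (root zero)))))
    go : _ → ∃[ i ] r i ≈ y
    go (yes y≈r₀) = zero , ≈-sym y≈r₀
    go (no y≉r₀)  = suc (proj₁ IH) , proj₂ IH
      where
      IH : ∃[ i ] r (suc i) ≈ y
      IH = monic-roots (quotient (r zero) c) (r ∘ suc)
        (λ i j rᵢ≈rⱼ → Fin.suc-injective (distinct (suc i) (suc j) rᵢ≈rⱼ))
        (λ i → factor (r (suc i))
          (λ rᵢ≈r₀ → contradiction (distinct (suc i) zero rᵢ≈r₀) λ ()) (root (suc i)))
        y (factor y y≉r₀ y-root)

  roots-of-unity : ∀ {n} → 0 < n → (r : Fin n → ℤ) → Distinct r →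
                   (∀ i → r i ^ n ≈ 1ℤ) → ∀ y → y ^ n ≈ 1ℤ → ∃[ i ] r i ≈ y
  roots-of-unity {suc n} _ r distinct root y y-root =
    -- These are the coefficients of `x ^ suc n - 1`; the leading 1 is implicit in `monic`.
    monic-roots (-1ℤ ∷ replicate n 0ℤ) r distinct (λ i → shift (r i) (root i)) y (shift y y-root)
    where
    power : ∀ n x → monic (replicate n 0ℤ) x ≡ x ^ n
    power zero    x = refl
    power (suc n) x = ≡.trans (ℤ.+-identityˡ _) (cong (x *_) (power n x))
    shift : ∀ x → x ^ suc n ≈ 1ℤ → monic (-1ℤ ∷ replicate n 0ℤ) x ≈ 0ℤ
    shift x h = +-cong { -1ℤ} ≈-refl (≈-trans (≡⇒≈ (cong (x *_) (power n x))) h)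

-- Power residues

module PowerResidues (p : ℕ) (p-prime : Prime p) (k : ℕ) {m : ℕ} (α : Fin m → ℤ)
                     (α-represents : RepresentsPowerResidues k p α) where

  open PrimeCongruence p p-prime
  open MonoidSum +-commutativeMonoid using (sum; sum-cong-≋; sum-permute)
  open SemiringSum semiring using (*-distribˡ-sum)
  open MonoidSum *-commutativeMonoid using ()
    renaming (sum to product; sum-cong-≋ to product-cong; sum-permute to product-permute)
  private module α = RepresentsPowerResidues α-represents

  Residue : ℤ → Set
  Residue = IsPowerResidue k p

  ≉0-Residue : ∀ {a} → Residue a → a ≉ 0ℤ
  ≉0-Residue res a≈0 = proj₁ res (difference a≈0)

  residue : ∀ {a} x → a ≉ 0ℤ → x ^ k ≈ a → Residue a
  residue x a≉0 xᵏ≈a = (a≉0 ∘ modulo) , x , difference xᵏ≈a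

  index : ∀ {a} → Residue a → Fin m
  index {a} res = proj₁ (α.complete a res)

  α-index : ∀ {a} (res : Residue a) → α (index res) ≈ a
  α-index {a} res = modulo (proj₂ (α.complete a res))

  α-distinct : Distinct α
  α-distinct i j αᵢ≈αⱼ = α.distinct i j (difference αᵢ≈αⱼ)

  α≉0 : ∀ i → α i ≉ 0ℤ
  α≉0 i = ≉0-Residue (α.residue i)

  residue-1 : Residue 1ℤ
  residue-1 = residue 1ℤ 1≉0 (≡⇒≈ (ℤ.^-zeroˡ k))

  residue-* : ∀ {a b} → Residue a → Residue b → Residue (a * b)
  residue-* {a} {b} ra@(_ , x , xᵏ≡a) rb@(_ , y , yᵏ≡b) =
    residue (x * y) (*-≉0 (≉0-Residue ra) (≉0-Residue rb))
      (≈-trans (≡⇒≈ (^-distribʳ-* x y k)) (*-cong {x ^ k} {a} {y ^ k} {b} (modulo xᵏ≡a) (modulo yᵏ≡b)))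

  residue-^ : ∀ {a} n → Residue a → Residue (a ^ n)
  residue-^ zero    ra = residue-1
  residue-^ (suc n) ra = residue-* ra (residue-^ n ra)

  -- By the pigeonhole principle two powers of c agree.
  inverse : ∀ {c} → Residue c → ∃[ c′ ] Residue c′ × c * c′ ≈ 1ℤ
  inverse {c} rc =
    let f = λ (e : Fin (suc m)) → index (residue-^ (toℕ e) rc)
        i , j , i<j , fᵢ≡fⱼ = Fin.pigeonhole (ℕ.n<1+n m) f
        e , 1+i+e≡j = ℕ.m≤n⇒∃[o]m+o≡n i<j
    in c ^ e , residue-^ e rc ,
       *-cancelˡ (c ^ toℕ i) (^-≉0 (toℕ i) (≉0-Residue rc)) (begin
         c ^ toℕ i * c ^ suc e                  ≡⟨ ℤ.^-distribˡ-+-* c (toℕ i) (suc e) ⟨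
         c ^ (toℕ i ℕ.+ suc e)                  ≡⟨ cong (c ^_) (≡.trans (ℕ.+-suc (toℕ i) e) 1+i+e≡j) ⟩
         c ^ toℕ j                              ≈⟨ α-index (residue-^ (toℕ j) rc) ⟨
         α (f j)                                ≡⟨ cong α fᵢ≡fⱼ ⟨
         α (f i)                                ≈⟨ α-index (residue-^ (toℕ i) rc) ⟩
         c ^ toℕ i                              ≡⟨ ℤ.*-identityʳ (c ^ toℕ i) ⟨
         c ^ toℕ i * 1ℤ                         ∎)
    where open SetoidReasoning setoid

  -- Multiplications by `c` and by an inverse residue undo each other; distinctness of the `α i`
  -- turns this congruence of values into an equality of indices.
  translation : ∀ {c} → Residue c → ∃[ π ] (∀ i → α (π ⟨$⟩ʳ i) ≈ c * α i)
  translation {c} rc = permutation (to rc) (to rc′)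
    (cancel rc rc′ cc′≈1) (cancel rc′ rc (≈-trans (≡⇒≈ (ℤ.*-comm c′ c)) cc′≈1)) , α-to rc
    where
    c′ = proj₁ (inverse rc)
    rc′ = proj₁ (proj₂ (inverse rc))
    cc′≈1 = proj₂ (proj₂ (inverse rc))
    to : ∀ {c} → Residue c → Fin m → Fin m
    to rc i = index (residue-* rc (α.residue i))
    α-to : ∀ {c} (rc : Residue c) i → α (to rc i) ≈ c * α i
    α-to rc i = α-index (residue-* rc (α.residue i))
    cancel : ∀ {c c′} (rc : Residue c) (rc′ : Residue c′) → c * c′ ≈ 1ℤ →
             ∀ i → to rc (to rc′ i) ≡ i
    cancel {c} {c′} rc rc′ cc′≈1 i = α-distinct _ i (begin
      α (to rc (to rc′ i)) ≈⟨ α-to rc (to rc′ i) ⟩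
      c * α (to rc′ i)     ≈⟨ *-congˡ {c} (α-to rc′ i) ⟩
      c * (c′ * α i)       ≡⟨ ℤ.*-assoc c c′ (α i) ⟨
      c * c′ * α i         ≈⟨ *-congʳ {α i} cc′≈1 ⟩
      1ℤ * α i             ≡⟨ ℤ.*-identityˡ (α i) ⟩
      α i                  ∎)
      where open SetoidReasoning setoid

  product-scale : ∀ {n} c (f : Fin n → ℤ) → product (λ i → c * f i) ≡ c ^ n * product f
  product-scale {zero}  c f = refl
  product-scale {suc n} c f =
    ≡.trans (cong (c * f zero *_) (product-scale c (f ∘ suc)))
      (eq c (f zero) (c ^ n) (product (f ∘ suc)))
    where
    eq : ∀ c x y z → c * x * (y * z) ≡ c * y * (x * z)
    eq = solve-∀

  product≉0 : ∀ {n} {f : Fin n → ℤ} → (∀ i → f i ≉ 0ℤ) → product f ≉ 0ℤ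
  product≉0 {zero}  f≉0 = 1≉0
  product≉0 {suc n} f≉0 = *-≉0 (f≉0 zero) (product≉0 (f≉0 ∘ suc))

  -- The classical proof of Fermat's theorem: multiplication by `c` permutes the `α i`, so their
  -- product is unchanged when multiplied by `c ^ m`, and it can be cancelled.
  residue^m≈1 : ∀ {c} → Residue c → c ^ m ≈ 1ℤ
  residue^m≈1 {c} rc = *-cancelˡ (product α) (product≉0 α≉0) (begin
    product α * c ^ m                ≡⟨ ℤ.*-comm (product α) (c ^ m) ⟩
    c ^ m * product α                ≡⟨ product-scale c α ⟨
    product (λ i → c * α i)          ≈⟨ product-cong (proj₂ (translation rc)) ⟨
    product (λ i → α (π ⟨$⟩ʳ i))     ≈⟨ product-permute α π ⟨
    product α                        ≡⟨ ℤ.*-identityʳ (product α) ⟨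
    product α * 1ℤ                   ∎)
    where
    open SetoidReasoning setoid
    π = proj₁ (translation rc)

  α^m≈1 : ∀ i → α i ^ m ≈ 1ℤ
  α^m≈1 i = residue^m≈1 (α.residue i)

  ^-period : ∀ {a} r q → a ^ m ≈ 1ℤ → a ^ (r ℕ.+ q ℕ.* m) ≈ a ^ r
  ^-period {a} r q aᵐ≈1 = begin
    a ^ (r ℕ.+ q ℕ.* m)   ≡⟨ ℤ.^-distribˡ-+-* a r (q ℕ.* m) ⟩
    a ^ r * a ^ (q ℕ.* m) ≡⟨ cong (λ e → a ^ r * a ^ e) (ℕ.*-comm q m) ⟩
    a ^ r * a ^ (m ℕ.* q) ≡⟨ cong (a ^ r *_) (ℤ.^-*-assoc a m q) ⟨
    a ^ r * (a ^ m) ^ q   ≈⟨ *-congˡ {a ^ r} (≈1⇒^≈1 q aᵐ≈1) ⟩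
    a ^ r * 1ℤ            ≡⟨ ℤ.*-identityʳ (a ^ r) ⟩
    a ^ r                 ∎
    where open SetoidReasoning setoid

  powerSum : ℕ → ℤ
  powerSum e = sum (λ j → α j ^ e)

  -- Otherwise the first `e` of the `α j` would be all the roots of `x ^ e = 1`, yet the one at
  -- index `e` is a further root.
  α^-not-trivial : ∀ e → 0 < e → e < m → ¬ (∀ j → α j ^ e ≈ 1ℤ)
  α^-not-trivial e 0<e e<m trivial =
    let j , eq = roots-of-unity 0<e (λ i → α (inject≤ i (ℕ.<⇒≤ e<m)))
          (λ i j αᵢ≈αⱼ → Fin.inject≤-injective _ _ i j (α-distinct _ _ αᵢ≈αⱼ))
          (λ i → trivial (inject≤ i (ℕ.<⇒≤ e<m)))
          (α (fromℕ< e<m)) (trivial (fromℕ< e<m))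
        open ≡.≡-Reasoning
    in ℕ.<⇒≢ (Fin.toℕ<n j) (begin
      toℕ j                           ≡⟨ Fin.toℕ-inject≤ j (ℕ.<⇒≤ e<m) ⟨
      toℕ (inject≤ j (ℕ.<⇒≤ e<m))     ≡⟨ cong toℕ (α-distinct _ _ eq) ⟩
      toℕ (fromℕ< e<m)                ≡⟨ Fin.toℕ-fromℕ< e<m ⟩
      e                               ∎)

  -- Some `c = α j` has `c ^ e` different from 1; it is found for the remainder `e % m`, which is
  -- positive and below `m`. Since multiplication by `c` permutes the summands, the sum is killed by
  -- `c ^ e - 1`.
  powerSum≈0 : .{{_ : NonZero m}} → ∀ e → ¬ (m ℕ∣.∣ e) → powerSum e ≈ 0ℤ
  powerSum≈0 e m∤e = Sum.[ (λ h → contradiction (-≈0⇒≈ h) cᵉ≉1) , (λ S≈0 → S≈0) ]′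
    (integral (c ^ e - 1ℤ) (powerSum e) (≈-trans (≡⇒≈ (eq (c ^ e) (powerSum e))) (≈⇒-≈0 cᵉS≈S)))
    where
    f = e % m
    0<f : 0 < f
    0<f = ℕ.n≢0⇒n>0 λ f≡0 → m∤e (ℕ∣.m%n≡0⇒n∣m e m f≡0)
    nontrivial : ∃[ j ] α j ^ f ≉ 1ℤ
    nontrivial = Fin.¬∀⟶∃¬ m _ (λ j → α j ^ f ≈? 1ℤ) (α^-not-trivial f 0<f (m%n<n e m))
    j = proj₁ nontrivial
    c = α j
    π = proj₁ (translation (α.residue j))
    cᵉ≉1 : c ^ e ≉ 1ℤ
    cᵉ≉1 cᵉ≈1 = proj₂ nontrivial (≈-trans
      (≈-sym (≈-trans (≡⇒≈ (cong (c ^_) (m≡m%n+[m/n]*n e m))) (^-period f (e / m) (α^m≈1 j))))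
      cᵉ≈1)
    open SetoidReasoning setoid
    permuted : ∀ i → c ^ e * α i ^ e ≈ α (π ⟨$⟩ʳ i) ^ e
    permuted i = ≈-trans (≡⇒≈ (≡.sym (^-distribʳ-* c (α i) e)))
      (^-congˡ e (≈-sym (proj₂ (translation (α.residue j)) i)))
    cᵉS≈S : c ^ e * powerSum e ≈ powerSum e
    cᵉS≈S = begin
      c ^ e * powerSum e                ≈⟨ *-distribˡ-sum (c ^ e) (λ j → α j ^ e) ⟩
      sum (λ i → c ^ e * α i ^ e)       ≈⟨ sum-cong-≋ permuted ⟩
      sum (λ i → α (π ⟨$⟩ʳ i) ^ e)      ≈⟨ sum-permute (λ i → α i ^ e) π ⟨
      powerSum e                        ∎
    eq : ∀ x S → (x - 1ℤ) * S ≡ x * S - S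
    eq = solve-∀

  α^≈1 : ∀ {e} → m ℕ∣.∣ e → ∀ j → α j ^ e ≈ 1ℤ
  α^≈1 (ℕ∣.divides q refl) j = ^-period 0 q (α^m≈1 j)

  -- All summands on both sides are 1. This is what makes the two surviving binomial terms
  -- comparable.
  powerSum-∣ : ∀ {e e′} → m ℕ∣.∣ e → m ℕ∣.∣ e′ → powerSum e ≈ powerSum e′
  powerSum-∣ m∣e m∣e′ = sum-cong-≋ λ j → ≈-trans (α^≈1 m∣e j) (≈-sym (α^≈1 m∣e′ j))

-- Orders and cosets

least : ∀ {ℓ} {P : ℕ → Set ℓ} → U.Decidable P → ∀ n → P n →
        ∃[ t ] P t × (∀ {s} → s < t → ¬ P s)
least {P = P} P? = <-rec _ step
  where
  step : ∀ n → (∀ {s} → s < n → P s → ∃[ t ] P t × (∀ {s} → s < t → ¬ P s)) →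
         P n → ∃[ t ] P t × (∀ {s} → s < t → ¬ P s)
  step n IH Pn with ℕ.anyUpTo? P? n
  ... | yes (s , s<n , Ps) = IH s<n Ps
  ... | no  none           = n , Pn , λ s<n Ps → none (_ , s<n , Ps)

module Order (p : ℕ) (p-prime : Prime p) (b : ℤ) where

  open PrimeCongruence p p-prime

  IsOrder : ℕ → Set
  IsOrder t = (0 < t × b ^ t ≈ 1ℤ) × (∀ {s} → s < t → ¬ (0 < s × b ^ s ≈ 1ℤ))

  order : ∀ n → 0 < n → b ^ n ≈ 1ℤ → ∃[ t ] IsOrder t
  order n 0<n bⁿ≈1 = least (λ s → (0 ℕ.<? s) ×-dec (b ^ s ≈? 1ℤ)) n (0<n , bⁿ≈1)

  module _ {t : ℕ} (t-order : IsOrder t) where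

    private
      instance
        t≢0 : NonZero t
        t≢0 = ℕ.>-nonZero (proj₁ (proj₁ t-order))
      bᵗ≈1 = proj₂ (proj₁ t-order)
      t-minimal = proj₂ t-order

    base≉0 : b ≉ 0ℤ
    base≉0 b≈0 = 1≉0 (≈-trans (≈-sym bᵗ≈1) (≈0⇒^≈0 t b≈0))

    -- The remainder `n % t` is again an exponent that gives 1, so by minimality of `t` it cannot be
    -- positive.
    order-∣ : ∀ n → b ^ n ≈ 1ℤ → t ℕ∣.∣ n
    order-∣ n bⁿ≈1 = ℕ∣.m%n≡0⇒n∣m n t (ℕ.n≤0⇒n≡0 (ℕ.≮⇒≥ λ 0<r → t-minimal (m%n<n n t) (0<r , bʳ≈1)))
      where
      open SetoidReasoning setoid
      q = n / t
      bʳ≈1 : b ^ (n % t) ≈ 1ℤ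
      bʳ≈1 = begin
        b ^ (n % t)                   ≡⟨ ℤ.*-identityʳ _ ⟨
        b ^ (n % t) * 1ℤ              ≈⟨ *-congˡ {b ^ (n % t)} (≈1⇒^≈1 q bᵗ≈1) ⟨
        b ^ (n % t) * (b ^ t) ^ q     ≡⟨ cong (b ^ (n % t) *_) (ℤ.^-*-assoc b t q) ⟩
        b ^ (n % t) * b ^ (t ℕ.* q)   ≡⟨ cong (λ e → b ^ (n % t) * b ^ e) (ℕ.*-comm t q) ⟩
        b ^ (n % t) * b ^ (q ℕ.* t)   ≡⟨ ℤ.^-distribˡ-+-* b (n % t) (q ℕ.* t) ⟨
        b ^ (n % t ℕ.+ q ℕ.* t)       ≡⟨ cong (b ^_) (m≡m%n+[m/n]*n n t) ⟨
        b ^ n                         ≈⟨ bⁿ≈1 ⟩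
        1ℤ                            ∎

    ^-distinct : ∀ {i j} → i < j → j < t → b ^ i ≉ b ^ j
    ^-distinct {i} {j} i<j j<t bⁱ≈bʲ = t-minimal (ℕ.≤-<-trans (ℕ.m∸n≤m j i) j<t)
      (ℕ.m<n⇒0<n∸m i<j , *-cancelˡ (b ^ i) (^-≉0 i base≉0) (begin
        b ^ i * b ^ (j ∸ i)   ≡⟨ ℤ.^-distribˡ-+-* b i (j ∸ i) ⟨
        b ^ (i ℕ.+ (j ∸ i))   ≡⟨ cong (b ^_) (ℕ.m+[n∸m]≡n (ℕ.<⇒≤ i<j)) ⟩
        b ^ j                 ≈⟨ bⁱ≈bʲ ⟨
        b ^ i                 ≡⟨ ℤ.*-identityʳ (b ^ i) ⟨
        b ^ i * 1ℤ            ∎))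
      where open SetoidReasoning setoid

    ^-injective : ∀ {i j} → i < t → j < t → b ^ i ≈ b ^ j → i ≡ j
    ^-injective {i} {j} i<t j<t bⁱ≈bʲ with ℕ.<-cmp i j
    ... | tri< i<j _ _ = contradiction bⁱ≈bʲ (^-distinct i<j j<t)
    ... | tri≈ _ i≡j _ = i≡j
    ... | tri> _ _ j<i = contradiction (≈-sym bⁱ≈bʲ) (^-distinct j<i i<t)

module Cosets (p : ℕ) (p-prime : Prime p) (k : ℕ) {m : ℕ} (α : Fin m → ℤ)
              (α-represents : RepresentsPowerResidues k p α)
              (d : ℤ) {t : ℕ} (t-order : Order.IsOrder p p-prime (d ^ m) t) where

  open PrimeCongruence p p-prime
  open PowerResidues p p-prime k α α-represents
  open Order p p-prime (d ^ m)
  open SetoidReasoning setoid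

  coset : Fin t → Fin m → ℤ
  coset i j = d ^ toℕ i * α j

  -- The `m`-th power forgets `α j` and retains the exponent of `d`. As `t` is the order of `d ^ m`,
  -- this separates the cosets.
  coset^m : ∀ i j → coset i j ^ m ≈ (d ^ m) ^ toℕ i
  coset^m i j = begin
    (d ^ toℕ i * α j) ^ m        ≡⟨ ^-distribʳ-* (d ^ toℕ i) (α j) m ⟩
    (d ^ toℕ i) ^ m * α j ^ m    ≈⟨ *-congˡ {(d ^ toℕ i) ^ m} (α^m≈1 j) ⟩
    (d ^ toℕ i) ^ m * 1ℤ         ≡⟨ ℤ.*-identityʳ _ ⟩
    (d ^ toℕ i) ^ m              ≡⟨ ℤ.^-*-assoc d (toℕ i) m ⟩
    d ^ (toℕ i ℕ.* m)            ≡⟨ cong (d ^_) (ℕ.*-comm (toℕ i) m) ⟩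
    d ^ (m ℕ.* toℕ i)            ≡⟨ ℤ.^-*-assoc d m (toℕ i) ⟨
    (d ^ m) ^ toℕ i              ∎

  coset-injective : d ≉ 0ℤ → ∀ i i′ j j′ → coset i j ≈ coset i′ j′ → i ≡ i′ × j ≡ j′
  coset-injective d≉0 i i′ j j′ eq = i≡i′ , α-distinct j j′ (*-cancelˡ (d ^ toℕ i)
      (^-≉0 (toℕ i) d≉0) (≈-trans eq (≡⇒≈ (cong (λ e → d ^ toℕ e * α j′) (≡.sym i≡i′)))))
    where
    i≡i′ = Fin.toℕ-injective (^-injective t-order (Fin.toℕ<n i) (Fin.toℕ<n i′)
      (≈-trans (≈-sym (coset^m i j)) (≈-trans (^-congˡ m eq) (coset^m i′ j′))))

  coset^mt : ∀ i j → coset i j ^ (m ℕ.* t) ≈ 1ℤ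
  coset^mt i j = begin
    coset i j ^ (m ℕ.* t)        ≡⟨ ℤ.^-*-assoc (coset i j) m t ⟨
    (coset i j ^ m) ^ t          ≈⟨ ^-congˡ t (coset^m i j) ⟩
    ((d ^ m) ^ toℕ i) ^ t        ≡⟨ ℤ.^-*-assoc (d ^ m) (toℕ i) t ⟩
    (d ^ m) ^ (toℕ i ℕ.* t)      ≡⟨ cong ((d ^ m) ^_) (ℕ.*-comm (toℕ i) t) ⟩
    (d ^ m) ^ (t ℕ.* toℕ i)      ≡⟨ ℤ.^-*-assoc (d ^ m) t (toℕ i) ⟨
    ((d ^ m) ^ t) ^ toℕ i        ≈⟨ ≈1⇒^≈1 (toℕ i) (proj₂ (proj₁ t-order)) ⟩
    1ℤ                           ∎

  -- The t m elements of the cosets are distinct roots of y ^ (t m) = 1.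
  ∈coset : 0 < m → d ≉ 0ℤ → ∀ y → y ^ (m ℕ.* t) ≈ 1ℤ → ∃[ i ] ∃[ j ] coset i j ≈ y
  ∈coset 0<m d≉0 y yᵐᵗ≈1 = row e , column e , proj₂ found
    where
    row : Fin (t ℕ.* m) → Fin t
    row e = proj₁ (remQuot m e)
    column : Fin (t ℕ.* m) → Fin m
    column e = proj₂ (remQuot {t} m e)
    distinct : Distinct (λ e → coset (row e) (column e))
    distinct e e′ eq =
      let i≡i′ , j≡j′ = coset-injective d≉0 _ _ _ _ eq
      in ≡.trans (≡.sym (Fin.combine-remQuot {t} m e))
           (≡.trans (cong₂ combine i≡i′ j≡j′) (Fin.combine-remQuot {t} m e′))
    exponent : ∀ {y} → y ^ (m ℕ.* t) ≈ 1ℤ → y ^ (t ℕ.* m) ≈ 1ℤ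
    exponent {y} = ≈-trans (≡⇒≈ (cong (y ^_) (ℕ.*-comm t m)))
    found : ∃[ e ] coset (row e) (column e) ≈ y
    found = roots-of-unity (ℕ.*-mono-< (proj₁ (proj₁ t-order)) 0<m) _ distinct
      (λ e → exponent (coset^mt (row e) (column e))) y (exponent yᵐᵗ≈1)
    e = proj₁ found

-- Characters

module Character {c ℓ₁ ℓ₂ : Level} (F : HeytingField c ℓ₁ ℓ₂) (F-char0 : CharacteristicZero F)
                 (p : ℕ) (p-prime : Prime p)
                 (k : ℕ) .{{_ : NonZero k}} {m : ℕ} (α : Fin m → ℤ)
                 (α-represents : RepresentsPowerResidues k p α)
                 (χ : ℤ → HeytingField.Carrier F) (χ-order : IsCharacterOfOrder F k p χ) where

  open PrimeCongruence p p-prime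
  open PowerResidues p p-prime k α α-represents
  private
    F-ring = HeytingCommutativeRing.commutativeRing (HeytingField.heytingCommutativeRing F)
    module F = CommutativeRing F-ring
    module E = Exp F.semiring
    module R = RingProperties F.ring
  open E using () renaming (_^_ to _^F_)
  open IsCharacterOfOrder χ-order
  open IsMultiplicativeCharacter isCharacter

  χ-cong : ∀ {a b} → a ≈ b → χ a F.≈ χ b
  χ-cong {a} {b} a≈b = periodic a b (difference a≈b)

  χ-^ : ∀ a n → χ (a ^ n) F.≈ χ a ^F n
  χ-^ a zero    = one
  χ-^ a (suc n) = F.trans (mult a (a ^ n)) (F.*-congˡ (χ-^ a n))

  k-th-root≉0 : ∀ {a x} → a ≉ 0ℤ → x ^ k ≈ a → x ≉ 0ℤ
  k-th-root≉0 a≉0 xᵏ≈a x≈0 = a≉0 (≈-trans (≈-sym xᵏ≈a) (≈0⇒^≈0 k x≈0))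

  χ-residue : ∀ {a} → Residue a → χ a F.≈ F.1#
  χ-residue {a} ra@(_ , x , xᵏ≡a) = begin
    χ a          ≈⟨ χ-cong xᵏ≈a ⟨
    χ (x ^ k)    ≈⟨ χ-^ x k ⟩
    χ x ^F k     ≈⟨ trivial x (λ x≡0 → k-th-root≉0 (≉0-Residue ra) xᵏ≈a (modulo x≡0)) ⟩
    F.1#         ∎
    where
    open SetoidReasoning F.setoid
    xᵏ≈a : x ^ k ≈ a
    xᵏ≈a = modulo xᵏ≡a

  χ-α : ∀ j → χ (α j) F.≈ F.1#
  χ-α j = χ-residue (RepresentsPowerResidues.residue α-represents j)

  1≉-1 : ¬ (F.1# F.≈ F.- F.1#)
  -- The argument 1 concerns `suc 1 · F.1#`, which unfolds to the first line of the chain.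
  1≉-1 1≈-1 = F-char0 1 (begin
    F.1# F.+ (F.1# F.+ F.0#) ≈⟨ F.+-congˡ (F.+-identityʳ F.1#) ⟩
    F.1# F.+ F.1#            ≈⟨ F.+-congˡ 1≈-1 ⟩
    F.1# F.+ F.- F.1#        ≈⟨ F.-‿inverseʳ F.1# ⟩
    F.0#                     ∎)
    where open SetoidReasoning F.setoid

  1^ : ∀ n → F.1# ^F n F.≈ F.1#
  1^ zero    = F.refl
  1^ (suc n) = F.trans (F.*-identityˡ _) (1^ n)

  module _ (0<m : 0 < m) (d : ℤ) (χd≈-1 : χ d F.≈ F.- F.1#) where

    d≉0 : d ≉ 0ℤ
    d≉0 d≈0 = F-char0 0 (begin
      F.1# F.+ F.0#      ≈⟨ F.+-identityʳ F.1# ⟩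
      F.1#               ≈⟨ R.-‿involutive F.1# ⟨
      F.- (F.- F.1#)     ≈⟨ F.-‿cong χd≈-1 ⟨
      F.- χ d            ≈⟨ F.-‿cong (vanishing d (difference d≈0)) ⟩
      F.- F.0#           ≈⟨ R.-0#≈0# ⟩
      F.0#               ∎)
      where open SetoidReasoning F.setoid

    χd²≈1 : χ d ^F 2 F.≈ F.1#
    χd²≈1 = begin
      χ d F.* (χ d F.* F.1#)              ≈⟨ F.*-congˡ (F.*-identityʳ (χ d)) ⟩
      χ d F.* χ d                         ≈⟨ F.*-cong χd≈-1 χd≈-1 ⟩
      (F.- F.1#) F.* (F.- F.1#)           ≈⟨ R.-1*x≈-x (F.- F.1#) ⟩
      F.- (F.- F.1#)                      ≈⟨ R.-‿involutive F.1# ⟩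
      F.1#                                ∎
      where open SetoidReasoning F.setoid

    -- The `α j` are all the roots of `x ^ m = 1`, so `d` would be congruent to one of them and
    -- `χ d` would be 1.
    d^m≉1 : d ^ m ≉ 1ℤ
    d^m≉1 dᵐ≈1 =
      let j , αⱼ≈d = roots-of-unity 0<m α α-distinct α^m≈1 d dᵐ≈1
      in 1≉-1 (F.trans (F.sym (χ-α j)) (F.trans (χ-cong αⱼ≈d) χd≈-1))

    -- Regrouped as `(d ^ k) ^ m`, this is the power of a residue. It shows that `d ^ m` has an
    -- order, and that the order divides `k`.
    d^m^k≈1 : (d ^ m) ^ k ≈ 1ℤ
    d^m^k≈1 = begin
      (d ^ m) ^ k        ≡⟨ ℤ.^-*-assoc d m k ⟩
      d ^ (m ℕ.* k)      ≡⟨ cong (d ^_) (ℕ.*-comm m k) ⟩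
      d ^ (k ℕ.* m)      ≡⟨ ℤ.^-*-assoc d k m ⟨
      (d ^ k) ^ m        ≈⟨ residue^m≈1 (residue d (^-≉0 k d≉0) ≈-refl) ⟩
      1ℤ                 ∎
      where open SetoidReasoning setoid

    open Order p p-prime (d ^ m)

    module _ {t : ℕ} (t-order : IsOrder t) where

      open Cosets p p-prime k α α-represents d t-order

      χ-coset² : ∀ i j → χ (coset i j) ^F 2 F.≈ F.1#
      χ-coset² i j = begin
        χ (d ^ toℕ i * α j) ^F 2                  ≈⟨ E.^-congˡ 2 (mult (d ^ toℕ i) (α j)) ⟩
        (χ (d ^ toℕ i) F.* χ (α j)) ^F 2          ≈⟨ E.^-congˡ 2 (F.*-cong (χ-^ d (toℕ i)) (χ-α j)) ⟩
        (χ d ^F toℕ i F.* F.1#) ^F 2              ≈⟨ E.^-congˡ 2 (F.*-identityʳ _) ⟩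
        (χ d ^F toℕ i) ^F 2                       ≈⟨ E.^-assocʳ (χ d) (toℕ i) 2 ⟩
        χ d ^F (toℕ i ℕ.* 2)                      ≡⟨ cong (χ d ^F_) (ℕ.*-comm (toℕ i) 2) ⟩
        χ d ^F (2 ℕ.* toℕ i)                      ≈⟨ E.^-assocʳ (χ d) 2 (toℕ i) ⟨
        (χ d ^F 2) ^F toℕ i                       ≈⟨ E.^-congˡ (toℕ i) χd²≈1 ⟩
        F.1# ^F toℕ i                             ≈⟨ 1^ (toℕ i) ⟩
        F.1#                                      ∎
        where open SetoidReasoning F.setoid

      -- Here `u` is `k / t`: the power `x ^ u` is a root of `y ^ (m t) = 1`, hence lies in a coset,
      -- where `χ` squares to 1.
      χ-power-trivial : ∀ u → u ℕ.* t ≡ k → PowerIsTrivial F p χ (u ℕ.* 2)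
      χ-power-trivial u ut≡k x x≢0 =
        let i , j , xᵘ≈ = ∈coset 0<m d≉0 (x ^ u) x^u^mt≈1
        in F.trans (F.sym (E.^-assocʳ (χ x) u 2))
            (F.trans (E.^-congˡ 2 (F.trans (F.sym (χ-^ x u)) (χ-cong (≈-sym xᵘ≈))))
              (χ-coset² i j))
        where
        open SetoidReasoning setoid
        exponents : u ℕ.* (m ℕ.* t) ≡ k ℕ.* m
        exponents = ≡.trans (cong (u ℕ.*_) (ℕ.*-comm m t))
          (≡.trans (≡.sym (ℕ.*-assoc u t m)) (cong (ℕ._* m) ut≡k))
        x^u^mt≈1 : (x ^ u) ^ (m ℕ.* t) ≈ 1ℤ
        x^u^mt≈1 = begin
          (x ^ u) ^ (m ℕ.* t)     ≡⟨ ℤ.^-*-assoc x u (m ℕ.* t) ⟩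
          x ^ (u ℕ.* (m ℕ.* t))   ≡⟨ cong (x ^_) exponents ⟩
          x ^ (k ℕ.* m)           ≡⟨ ℤ.^-*-assoc x k m ⟨
          (x ^ k) ^ m             ≈⟨ residue^m≈1 (residue x (^-≉0 k (x≢0 ∘ difference)) ≈-refl) ⟩
          1ℤ                      ∎

      -- If `2 < t`, then `u * 2` would be a positive exponent below `u * t = k` with trivial power,
      -- against the minimality of the order of `χ`.
      order≤2 : t ≤ 2
      order≤2 = ℕ.≮⇒≥ λ 2<t →
        let ℕ∣.divides u k≡ut = order-∣ t-order k d^m^k≈1
            0<u : 0 < u
            0<u = ℕ.n≢0⇒n>0 λ u≡0 → ℕ.≢-nonZero⁻¹ k (≡.trans k≡ut (cong (ℕ._* t) u≡0))
        in minimal (u ℕ.* 2) (ℕ.*-mono-< 0<u (z<s {1}))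
             (subst (u ℕ.* 2 <_) (≡.sym k≡ut) (ℕ.*-monoʳ-< u {{ℕ.>-nonZero 0<u}} 2<t))
             (χ-power-trivial u (≡.sym k≡ut))

    -- Carries the hypothesis on `χ` over to the congruence used for the determinant. Order 1 is
    -- excluded, and order 2 gives `(b - 1) (b + 1) = 0` with a nonzero first factor.
    d^m≈-1 : d ^ m ≈ -1ℤ
    d^m≈-1 = go (order k (ℕ.>-nonZero⁻¹ k) d^m^k≈1)
      where
      b = d ^ m
      factored : ∀ b → (b - 1ℤ) * (b - -1ℤ) ≡ b * (b * 1ℤ) - 1ℤ
      factored = solve-∀
      go : ∃[ t ] IsOrder t → b ≈ -1ℤ
      go (t , t-order) = by-order t (order≤2 t-order) t-order
        where
        by-order : ∀ t → t ≤ 2 → IsOrder t → b ≈ -1ℤ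
        by-order zero _ ((() , _) , _)
        by-order (suc zero) _ ((_ , b¹≈1) , _) =
          contradiction (≈-trans (≡⇒≈ (≡.sym (ℤ.*-identityʳ b))) b¹≈1) d^m≉1
        by-order (suc (suc zero)) _ ((_ , b²≈1) , _) =
          Sum.[ (λ b-1≈0 → contradiction (-≈0⇒≈ b-1≈0) d^m≉1) , -≈0⇒≈ {b} { -1ℤ} ]′
            (integral (b - 1ℤ) (b - -1ℤ) (≈-trans (≡⇒≈ (factored b)) (≈⇒-≈0 b²≈1)))
        by-order (suc (suc (suc t))) (ℕ.s≤s (ℕ.s≤s ())) _

-- The kernel vector

module _ (p : ℕ) (p-prime : Prime p) (2∤p : ¬ (2 ℕ∣.∣ p)) where

  open PrimeCongruence p p-prime
  open MonoidSum +-commutativeMonoid using 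
    (sum; sum-cong-≋; sum-permute; ∑-distrib-+; ∑-comm; sum-replicate-zero)
  open SemiringSum semiring using (*-distribˡ-sum; *-distribʳ-sum)
  open Mult semiring using (×-assoc-*; ×-congʳ) renaming (_×_ to _·_)

  2≉0 : + 2 ≉ 0ℤ
  2≉0 2≈0 = 2∤p (ℕ∣.∣-reflexive (≡.sym (ℕ.≤-antisym (ℕ∣.∣⇒≤ (∣⇒∣ᵤ (≈0⇒∣ 2≈0)))
    (ℕ.nonTrivial⇒n>1 p {{prime⇒nonTrivial p-prime}}))))

  -- Adding the sum to its reversal gives twice the sum, and 2 can be cancelled for odd `p`.
  -- Doubling also covers a middle index fixed by `opposite`.
  sum-antisymmetric : ∀ {n} (f : Fin n → ℤ) → (∀ i → f i + f (opposite i) ≈ 0ℤ) → sum f ≈ 0ℤ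
  sum-antisymmetric {n} f anti = Sum.[ (λ 2≈0 → contradiction 2≈0 2≉0) , (λ S≈0 → S≈0) ]′
    (integral (+ 2) (sum f) (begin
      + 2 * sum f                       ≡⟨ double (sum f) ⟩
      sum f + sum f                     ≈⟨ +-cong (≈-refl {sum f}) (sum-permute f Permutation.reverse) ⟩
      sum f + sum (f ∘ opposite)        ≈⟨ ∑-distrib-+ f (f ∘ opposite) ⟨
      sum (λ i → f i + f (opposite i))  ≈⟨ sum-cong-≋ anti ⟩
      sum {n} (λ _ → 0ℤ)                ≈⟨ sum-replicate-zero n ⟩
      0ℤ                                ∎))
    where
    open SetoidReasoning setoid
    double : ∀ x → + 2 * x ≡ x + x
    double = solve-∀

  -- The binomial theorem with each multiple by `n C e` written as a product with the integer
  -- `(n C e) · 1ℤ`, which can be moved by ring identities.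
  binomial-expansion : ∀ x y n →
    (x + y) ^ n ≈ sum {suc n} (λ e → ((n C toℕ e) · 1ℤ) * (x ^ toℕ e * y ^ (n ∸ toℕ e)))
  binomial-expansion x y n = begin
    (x + y) ^ n                        ≡⟨ ^E≡^ (x + y) n ⟨
    (x + y) ^E n                       ≈⟨ Binomial.theorem commutativeSemiring n x y ⟩
    sum {suc n} (λ e → (n C toℕ e) · (x ^E toℕ e * y ^E (n ∸ toℕ e)))
                                       ≈⟨ sum-cong-≋ {suc n} (λ e → ≈-trans
                                            (×-congʳ (n C toℕ e) (≡⇒≈ (≡.trans
                                              (cong₂ _*_ (^E≡^ x (toℕ e)) (^E≡^ y (n ∸ toℕ e)))
                                              (≡.sym (ℤ.*-identityˡ _)))))
                                            (≈-sym (×-assoc-* (n C toℕ e) 1ℤ _))) ⟩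
    sum {suc n} (λ e → ((n C toℕ e) · 1ℤ) * (x ^ toℕ e * y ^ (n ∸ toℕ e))) ∎
    where
    open SetoidReasoning setoid
    open Exp semiring using () renaming (_^_ to _^E_)
    ^E≡^ : ∀ x n → x ^E n ≡ x ^ n
    ^E≡^ x zero    = refl
    ^E≡^ x (suc n) = cong (x *_) (^E≡^ x n)

  -- The kernel vector has entries `α j ^ s`, where `s` is `m - r`; the equation `r + s ≡ m`
  -- replaces truncated subtraction.
  module _ (k : ℕ) {m : ℕ} (α : Fin m → ℤ) (α-represents : RepresentsPowerResidues k p α)
           (d : ℤ) (dᵐ≈-1 : d ^ m ≈ -1ℤ) (r s : ℕ) (0<s : 0 < s) (r+s≡m : r ℕ.+ s ≡ m)
           (n : ℕ) (n≡m+r+r : n ≡ m ℕ.+ (r ℕ.+ r)) where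

    open PowerResidues p p-prime k α α-represents
    private instance
      m≢0 : NonZero m
      m≢0 = ℕ.>-nonZero (ℕ.<-≤-trans 0<s (ℕ.≤-trans (ℕ.m≤n+m s r) (ℕ.≤-reflexive r+s≡m)))

    -- Let `f + s = q m`. Since `s` is positive, `q` is not 0; since `f + s` is at most
    -- `n + s = 2 m + r`, which is below `3 m`, only `q = 1` and `q = 2` remain.
    surviving-exponents : ∀ {e f} → e ℕ.+ f ≡ n → m ℕ∣.∣ f ℕ.+ s →
                          (f ≡ r × e ≡ m ℕ.+ r) ⊎ (f ≡ m ℕ.+ r × e ≡ r)
    surviving-exponents {e} {f} e+f≡n (ℕ∣.divides q f+s≡qm) = go q f+s≡qm
      where
      open ℕ.≤-Reasoning
      go : ∀ q → f ℕ.+ s ≡ q ℕ.* m → (f ≡ r × e ≡ m ℕ.+ r) ⊎ (f ≡ m ℕ.+ r × e ≡ r)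
      go 0 eq = contradiction (ℕ.m+n≡0⇒n≡0 f eq) (ℕ.>⇒≢ 0<s)
      go 1 eq = inj₁ (f≡r , ℕ.+-cancelʳ-≡ r e (m ℕ.+ r) (begin-equality
          e ℕ.+ r              ≡⟨ cong (e ℕ.+_) f≡r ⟨
          e ℕ.+ f              ≡⟨ e+f≡n ⟩
          n                    ≡⟨ n≡m+r+r ⟩
          m ℕ.+ (r ℕ.+ r)      ≡⟨ ℕ.+-assoc m r r ⟨
          m ℕ.+ r ℕ.+ r        ∎))
        where
        f≡r : f ≡ r
        f≡r = ℕ.+-cancelʳ-≡ s f r (≡.trans eq (≡.trans (ℕ.*-identityˡ m) (≡.sym r+s≡m)))
      go 2 eq = inj₂ (f≡m+r , ℕ.+-cancelˡ-≡ (m ℕ.+ r) e r (begin-equality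
          m ℕ.+ r ℕ.+ e        ≡⟨ cong (ℕ._+ e) f≡m+r ⟨
          f ℕ.+ e              ≡⟨ ℕ.+-comm f e ⟩
          e ℕ.+ f              ≡⟨ e+f≡n ⟩
          n                    ≡⟨ n≡m+r+r ⟩
          m ℕ.+ (r ℕ.+ r)      ≡⟨ ℕ.+-assoc m r r ⟨
          m ℕ.+ r ℕ.+ r        ∎))
        where
        f≡m+r : f ≡ m ℕ.+ r
        f≡m+r = ℕ.+-cancelʳ-≡ s f (m ℕ.+ r) (begin-equality
          f ℕ.+ s              ≡⟨ eq ⟩
          m ℕ.+ (m ℕ.+ 0)      ≡⟨ cong (m ℕ.+_) (≡.trans (ℕ.+-identityʳ m) (≡.sym r+s≡m)) ⟩
          m ℕ.+ (r ℕ.+ s)      ≡⟨ ℕ.+-assoc m r s ⟨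
          m ℕ.+ r ℕ.+ s        ∎)
      go (suc (suc (suc q))) eq = contradiction eq (ℕ.<⇒≢ (begin-strict
          f ℕ.+ s                       ≤⟨ ℕ.+-monoˡ-≤ s (ℕ.m≤n+m f e) ⟩
          e ℕ.+ f ℕ.+ s                 ≡⟨ cong (ℕ._+ s) (≡.trans e+f≡n n≡m+r+r) ⟩
          m ℕ.+ (r ℕ.+ r) ℕ.+ s         ≡⟨ regroup m r s ⟩
          m ℕ.+ ((r ℕ.+ s) ℕ.+ r)       ≡⟨ cong (λ z → m ℕ.+ (z ℕ.+ r)) r+s≡m ⟩
          m ℕ.+ (m ℕ.+ r)               <⟨ ℕ.+-monoʳ-< m (ℕ.+-monoʳ-< m r<m) ⟩
          m ℕ.+ (m ℕ.+ m)               ≤⟨ ℕ.+-monoʳ-≤ m (ℕ.+-monoʳ-≤ m (ℕ.m≤m+n m (q ℕ.* m))) ⟩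
          m ℕ.+ (m ℕ.+ (m ℕ.+ q ℕ.* m)) ∎))
        where
        r<m : r < m
        r<m = ℕ.<-≤-trans (ℕ.m<m+n r 0<s) (ℕ.≤-reflexive r+s≡m)
        regroup : ∀ m r s → m ℕ.+ (r ℕ.+ r) ℕ.+ s ≡ m ℕ.+ ((r ℕ.+ s) ℕ.+ r)
        regroup = ℕ-Solver.solve-∀

    module _ (i : Fin m) where

      open SetoidReasoning setoid

      coefficient : ℕ → ℕ → ℤ
      coefficient e f = ((n C e) · 1ℤ) * (α i ^ e * d ^ f)

      -- The contribution to row `i` of the matrix times the kernel vector from the binomial term
      -- with `α i` to the power `e` and `d α j` to the power `f`. Keeping `e` and `f` separate
      -- makes their exchange expressible.
      term : ℕ → ℕ → ℤ
      term e f = coefficient e f * powerSum (f ℕ.+ s)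

      -- Binomial symmetry equates the coefficients, `α i ^ m = 1` the powers of `α i`, and `m`
      -- divides both exponents of the power sums; `d ^ m = -1` supplies the opposite sign.
      survivors-cancel : term (m ℕ.+ r) r + term r (m ℕ.+ r) ≈ 0ℤ
      survivors-cancel = begin
        term (m ℕ.+ r) r + term r (m ℕ.+ r)
          ≈⟨ +-cong (*-cong (*-cong (≡⇒≈ (cong (_· 1ℤ) C-sym)) (*-congʳ {D} a-period)) ≈-refl)
                    (*-cong (*-congˡ {c} (*-congˡ {A} d-antiperiod)) (powerSum-∣ m∣m+r+s m∣r+s)) ⟩
        c * (A * D) * P + c * (A * (-1ℤ * D)) * P
          ≡⟨ cancel c A D P ⟩
        0ℤ ∎
        where
        c = (n C r) · 1ℤ
        A = α i ^ r
        D = d ^ r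
        P = powerSum (r ℕ.+ s)
        C-sym : n C (m ℕ.+ r) ≡ n C r
        C-sym = ≡.sym (≡.trans
          (nCk≡nC[n∸k] (subst (r ≤_) (≡.sym n≡m+r+r) (ℕ.≤-trans (ℕ.m≤m+n r r) (ℕ.m≤n+m _ m))))
          (cong (n C_) (≡.trans (cong (_∸ r) (≡.trans n≡m+r+r (≡.sym (ℕ.+-assoc m r r))))
            (ℕ.m+n∸n≡m (m ℕ.+ r) r))))
        a-period : α i ^ (m ℕ.+ r) ≈ A
        a-period = ≈-trans (≡⇒≈ (ℤ.^-distribˡ-+-* (α i) m r))
          (≈-trans (*-congʳ {A} (α^m≈1 i)) (≡⇒≈ (ℤ.*-identityˡ A)))
        d-antiperiod : d ^ (m ℕ.+ r) ≈ -1ℤ * D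
        d-antiperiod = ≈-trans (≡⇒≈ (ℤ.^-distribˡ-+-* d m r)) (*-congʳ {D} dᵐ≈-1)
        m∣r+s : m ℕ∣.∣ r ℕ.+ s
        m∣r+s = ℕ∣.∣-reflexive (≡.sym r+s≡m)
        m∣m+r+s : m ℕ∣.∣ m ℕ.+ r ℕ.+ s
        m∣m+r+s = subst (m ℕ∣.∣_) (≡.sym (ℕ.+-assoc m r s)) (ℕ∣.∣m∣n⇒∣m+n ℕ∣.∣-refl m∣r+s)
        cancel : ∀ c A D P → c * (A * D) * P + c * (A * (-1ℤ * D)) * P ≡ 0ℤ
        cancel = solve-∀

      -- The two surviving pairs of exponents are exchanged by swapping `e` and `f`. If neither
      -- order survives, both terms vanish through their power sums.
      terms-cancel : ∀ e f → e ℕ.+ f ≡ n → term e f + term f e ≈ 0ℤ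
      terms-cancel e f e+f≡n = go (m ℕ∣.∣? f ℕ.+ s) (m ℕ∣.∣? e ℕ.+ s)
        where
        swap : term f e + term e f ≈ 0ℤ → term e f + term f e ≈ 0ℤ
        swap = ≈-trans (≡⇒≈ (ℤ.+-comm (term e f) (term f e)))
        survive : ∀ {e f} → (f ≡ r × e ≡ m ℕ.+ r) ⊎ (f ≡ m ℕ.+ r × e ≡ r) →
                  term e f + term f e ≈ 0ℤ
        survive (inj₁ (refl , refl)) = survivors-cancel
        survive (inj₂ (refl , refl)) =
          ≈-trans (≡⇒≈ (ℤ.+-comm (term r (m ℕ.+ r)) (term (m ℕ.+ r) r))) survivors-cancel
        vanish : ∀ e f → ¬ (m ℕ∣.∣ f ℕ.+ s) → term e f ≈ 0ℤ
        vanish e f m∤ = ≈-trans (*-congˡ {coefficient e f} (powerSum≈0 (f ℕ.+ s) m∤))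
          (≡⇒≈ (ℤ.*-zeroʳ (coefficient e f)))
        go : _ → _ → term e f + term f e ≈ 0ℤ
        go (yes m∣f+s) _           = survive (surviving-exponents e+f≡n m∣f+s)
        go (no _)      (yes m∣e+s) =
          swap (survive (surviving-exponents (≡.trans (ℕ.+-comm f e) e+f≡n) m∣e+s))
        go (no m∤f+s)  (no m∤e+s)  = +-cong (vanish e f m∤f+s) (vanish f e m∤e+s)

      row-expansion : ∀ j → (α i + d * α j) ^ n * α j ^ s ≈
        sum {suc n} (λ e → coefficient (toℕ e) (n ∸ toℕ e) * α j ^ (n ∸ toℕ e ℕ.+ s))
      row-expansion j = begin
        (α i + d * α j) ^ n * α j ^ s
          ≈⟨ *-congʳ {α j ^ s} (binomial-expansion (α i) (d * α j) n) ⟩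
        sum b * α j ^ s
          ≈⟨ *-distribʳ-sum (α j ^ s) b ⟩
        sum (λ e → b e * α j ^ s)
          ≈⟨ sum-cong-≋ {suc n} (λ e → ≡⇒≈ (regroup (C· e) (α i ^ toℕ e) (n ∸ toℕ e))) ⟩
        sum {suc n} (λ e → coefficient (toℕ e) (n ∸ toℕ e) * α j ^ (n ∸ toℕ e ℕ.+ s)) ∎
        where
        C· : Fin (suc n) → ℤ
        C· e = (n C toℕ e) · 1ℤ
        b : Fin (suc n) → ℤ
        b e = C· e * (α i ^ toℕ e * (d * α j) ^ (n ∸ toℕ e))
        assoc : ∀ c x y z w → c * (x * (y * z)) * w ≡ c * (x * y) * (z * w)
        assoc = solve-∀
        regroup : ∀ c x f → c * (x * (d * α j) ^ f) * α j ^ s ≡ c * (x * d ^ f) * α j ^ (f ℕ.+ s)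
        regroup c x f = ≡.trans (cong (λ z → c * (x * z) * α j ^ s) (^-distribʳ-* d (α j) f))
          (≡.trans (assoc c x (d ^ f) (α j ^ f) (α j ^ s))
            (cong (c * (x * d ^ f) *_) (≡.sym (ℤ.^-distribˡ-+-* (α j) f s))))

      -- Summing over `j` first turns the binomial expansion into power sums; reversing the index
      -- then pairs `e` with `n - e`, and each pair cancels.
      row-in-kernel : sum (λ j → (α i + d * α j) ^ n * α j ^ s) ≈ 0ℤ
      row-in-kernel = begin
        sum (λ j → (α i + d * α j) ^ n * α j ^ s)
          ≈⟨ sum-cong-≋ row-expansion ⟩
        sum (λ j → sum {suc n} (λ e → c e * α j ^ (n ∸ toℕ e ℕ.+ s)))
          ≈⟨ ∑-comm {m} {suc n} (λ j e → c e * α j ^ (n ∸ toℕ e ℕ.+ s)) ⟩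
        sum {suc n} (λ e → sum (λ j → c e * α j ^ (n ∸ toℕ e ℕ.+ s)))
          ≈⟨ sum-cong-≋ {suc n} (λ e → *-distribˡ-sum (c e) (λ j → α j ^ (n ∸ toℕ e ℕ.+ s))) ⟨
        sum {suc n} (λ e → term (toℕ e) (n ∸ toℕ e))
          ≈⟨ sum-antisymmetric {suc n} (λ e → term (toℕ e) (n ∸ toℕ e)) anti ⟩
        0ℤ ∎
        where
        c : Fin (suc n) → ℤ
        c e = coefficient (toℕ e) (n ∸ toℕ e)
        anti : ∀ e → term (toℕ e) (n ∸ toℕ e) +
               term (toℕ (opposite e)) (n ∸ toℕ (opposite e)) ≈ 0ℤ
        anti e = ≈-trans
          (≡⇒≈ (cong (λ z → term (toℕ e) (n ∸ toℕ e) + z)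
            (cong₂ term (Fin.opposite-prop e)
              (≡.trans (cong (n ∸_) (Fin.opposite-prop e)) (ℕ.m∸[m∸n]≡n e≤n)))))
          (terms-cancel (toℕ e) (n ∸ toℕ e) (ℕ.m+[n∸m]≡n e≤n))
          where
          e≤n : toℕ e ≤ n
          e≤n = Fin.toℕ≤pred[n] e

  -- The kernel vector makes `p` divide its first entry times the determinant, and that entry, a
  -- power of `α zero`, is invertible.
  det≈0 : ∀ k {m} (α : Fin m → ℤ) → RepresentsPowerResidues k p α →
          ∀ d → d ^ m ≈ -1ℤ → ∀ r s → 0 < s → r ℕ.+ s ≡ m → ∀ n → n ≡ m ℕ.+ (r ℕ.+ r) →
          det (λ i j → (α i + d * α j) ^ n) ≈ 0ℤ
  det≈0 k {zero}  α α-rep d dᵐ≈-1 r s 0<s r+s≡m n n≡ =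
    contradiction (ℕ.m+n≡0⇒n≡0 r r+s≡m) (ℕ.>⇒≢ 0<s)
  det≈0 k {suc m} α α-rep d dᵐ≈-1 r s 0<s r+s≡m n n≡ =
    *-cancelˡ (α zero ^ s) (^-≉0 s (α≉0 zero))
      (≈-trans (∣⇒≈0 (kernel⇒∣x₀*det (λ i j → (α i + d * α j) ^ n) (λ j → α j ^ s)
        (λ i → ≈0⇒∣ (row-in-kernel k α α-rep d dᵐ≈-1 r s 0<s r+s≡m n n≡ i))))
        (≡⇒≈ (≡.sym (ℤ.*-zeroʳ (α zero ^ s)))))
    where open PowerResidues p p-prime k α α-rep

-- From the hypotheses to the exponents, and the theorem

mod⇒∣∸ : ∀ {z a b} → b ≤ a → (+ a) ≡ (+ b) mod z → z ℕ∣.∣ a ∸ b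
mod⇒∣∸ {z} {a} {b} b≤a a≡b = subst (z ℕ∣.∣_)
  (≡.trans (cong ∣_∣ (ℤ.m-n≡m⊖n a b)) (cong ∣_∣ (ℤ.⊖-≥ b≤a))) (∣⇒∣ᵤ a≡b)

theorem1p1 : ∀ {c ℓ₁ ℓ₂ : Level} (F : HeytingField c ℓ₁ ℓ₂) →
    let module F = HeytingField F in
    CharacteristicZero F →
    (p k : ℕ) .{{_ : NonZero k}} →
    Prime p → 2 ∤ p →
    2 ≤ k → k ≤ (p ∸ 1) / 2 →
    2 ℕ.* k ℕ.+ 1 < p →
    (+ p) ≡ (+ 1) mod k →
    (α : Fin ((p ∸ 1) / k) → ℤ) → RepresentsPowerResidues k p α →
    (χ : ℤ → F.Carrier) → IsCharacterOfOrder F k p χ →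
    (n : ℕ) → (p ∸ 1) / k ℕ.+ 1 ≤ n → n ≤ (2 ℕ.* (p ∸ 1)) / k ∸ 1 →
    (+ n) ≡ (+ ((p ∸ 1) / k)) mod 2 →
    (d : ℤ) → χ d F.≈ F.- F.1# →
    S n k d p α ≡ (+ 0) mod p
theorem1p1 F F-char0 p k p-prime 2∤p _ _ _ p≡1 α α-rep χ χ-order n m+1≤n n≤2m-1 n≡m d χd≈-1 =
  Congruence.difference (det≈0 p p-prime 2∤p k α α-rep d
    (Character.d^m≈-1 F F-char0 p p-prime k α α-rep χ χ-order 0<m d χd≈-1)
    r (m ∸ r) (ℕ.m<n⇒0<n∸m r<m) (ℕ.m+[n∸m]≡n (ℕ.<⇒≤ r<m)) n n≡m+r+r)
  where
  open ≡.≡-Reasoning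
  m = (p ∸ 1) / k
  k∣p-1 : k ℕ∣.∣ p ∸ 1
  k∣p-1 = mod⇒∣∸ (ℕ.<⇒≤ (ℕ.nonTrivial⇒n>1 p {{prime⇒nonTrivial p-prime}})) p≡1
  -- The division rounds down, so the factor 2 comes out because `k` divides `p ∸ 1`.
  2[p-1]/k≡2m : (2 ℕ.* (p ∸ 1)) / k ≡ 2 ℕ.* m
  2[p-1]/k≡2m = *-/-assoc 2 k∣p-1
  m<n : m < n
  m<n = subst (_≤ n) (ℕ.+-comm m 1) m+1≤n
  n<2m : n < 2 ℕ.* m
  n<2m = bound (2 ℕ.* m) (subst (λ z → n ≤ z ∸ 1) 2[p-1]/k≡2m n≤2m-1)
    where
    bound : ∀ z → n ≤ z ∸ 1 → n < z
    -- For `z = 0` the truncated `z ∸ 1` is 0, so the claim fails unless `n` is known to be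
    -- positive; `m < n` ensures this.
    bound zero    n≤0 = contradiction (ℕ.<-≤-trans m<n n≤0) λ ()
    bound (suc z) n≤z = ℕ.s≤s n≤z
  2∣n-m : 2 ℕ∣.∣ n ∸ m
  2∣n-m = mod⇒∣∸ (ℕ.<⇒≤ m<n) n≡m
  -- Half of the even number `n ∸ m`; the bound `n < 2 m` keeps it below `m`, so that `s = m ∸ r` is
  -- positive.
  r = ℕ∣.quotient 2∣n-m
  n≡m+r+r : n ≡ m ℕ.+ (r ℕ.+ r)
  n≡m+r+r = begin
    n                    ≡⟨ ℕ.m+[n∸m]≡n (ℕ.<⇒≤ m<n) ⟨
    m ℕ.+ (n ∸ m)        ≡⟨ cong (m ℕ.+_) (ℕ∣._∣_.equality 2∣n-m) ⟩
    m ℕ.+ r ℕ.* 2        ≡⟨ cong (m ℕ.+_) (double r) ⟩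
    m ℕ.+ (r ℕ.+ r)      ∎
    where
    double : ∀ r → r ℕ.* 2 ≡ r ℕ.+ r
    double = ℕ-Solver.solve-∀
  r+r<m : r ℕ.+ r < m
  r+r<m = ℕ.+-cancelˡ-< m (r ℕ.+ r) m (ℕ.≤-trans (ℕ.≤-<-trans (ℕ.≤-reflexive (≡.sym n≡m+r+r)) n<2m)
    (ℕ.≤-reflexive (cong (m ℕ.+_) (ℕ.+-identityʳ m))))
  r<m : r < m
  r<m = ℕ.≤-<-trans (ℕ.m≤m+n r r) r+r<m
  0<m : 0 < m
  0<m = ℕ.≤-<-trans ℕ.z≤n r<m
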